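{- Let $G$ be a simple bipartite edge-magic graph with stable sets $X=\{x_i\}_{i=1}^s$ and $Y=\{y_j\}_{j=1}^t$, let $n\ge1$, and suppose $G\cong H_1\oplus H_2$ is a decomposition of $G$. Then $|\tau_{S_{2n}(G;H_1,H_2)}|\ge (n+1)|\tau_G|+2$.
   Context: A decomposition $G\cong H_1\oplus H_2$ means $H_1,H_2$ are subgraphs of $G$ whose edge sets partition $E(G)$. An edge-magic labeling of a graph with $p$ vertices and $q$ edges is a bijection $f:V\cup E\to[1,p+q]$ such that $f(x)+f(xy)+f(y)$ is a constant (the valence) over all edges $xy$; here $[a,b]=\{a,\dots,b\}$. Let $T_G=\{(\sum_{u\in V}\deg(u)g(u)+\sum_{e\in E}g(e))/q: g:V\cup E\to[1,p+q]\text{ bijective}\}$, $J_G=[\lceil\min T_G\rceil,\lfloor\max T_G\rfloor]$ and $\tau_G=\{k\in J_G: k\text{ is the valence of some edge-magic labeling of }G\}$. $S_{2n}(G;H_1,H_2)$ is the graph with vertex set $X\cup Y\cup\bigcup_{k=1}^n X_k\cup\bigcup_{k=1}^n Y_k$, where $X_k=\{x_i^k\}_{i=1}^s$, $Y_k=\{y_j^k\}_{j=1}^t$ are new vertices, and edge set $E(G)\cup\{x_iy_j^k: x_iy_j\in E(H_1),\,k\in[1,n]\}\cup\{x_i^ky_j: x_iy_j\in E(H_2),\,k\in[1,n]\}$. -}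

module Defs where

open import Data.Bool using (Bool; true; false; if_then_else_)
open import Data.Nat using (ℕ; zero; suc; _+_; _*_; _≤_)
open import Data.Fin using (Fin; toℕ; splitAt; remQuot)
open import Data.List using (List; map; allFin; length)
open import Data.Nat.ListAction using (sum)
open import Data.List.Relation.Unary.All using (All)
open import Data.List.Relation.Unary.Unique.Propositional using (Unique)
open import Data.Product using (Σ; ∃; ∃-syntax; _×_; _,_; proj₁; proj₂)
open import Data.Sum using (_⊎_; inj₁; inj₂)
open import Function.Bundles using (_⤖_; Bijection)
open import Relation.Binary.PropositionalEquality using (_≡_; refl)

-- Simple bipartite graphs with a fixed bipartition: left part Fin a
-- (the stable set X), right part Fin b (the stable set Y); an (undirected)
-- edge x_i y_j is present iff  E i j ≡ true.  Such graphs are automatically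
-- simple (no loops, no multiple edges).

BGraph : ℕ → ℕ → Set
BGraph a b = Fin a → Fin b → Bool

∑ : (m : ℕ) → (Fin m → ℕ) → ℕ
∑ m f = sum (map f (allFin m))

χ : Bool → ℕ
χ true  = 1
χ false = 0

Edge : ∀ {a b} → BGraph a b → Set
Edge {a} {b} E = Σ (Fin a × Fin b) λ p → E (proj₁ p) (proj₂ p) ≡ true

numEdges : ∀ {a b} → BGraph a b → ℕ
numEdges {a} {b} E = ∑ a λ i → ∑ b λ j → χ (E i j)

degL : ∀ {a b} → BGraph a b → Fin a → ℕ
degL {a} {b} E i = ∑ b λ j → χ (E i j)

degR : ∀ {a b} → BGraph a b → Fin b → ℕ
degR {a} {b} E j = ∑ a λ i → χ (E i j)

Elem : ∀ {a b} → BGraph a b → Set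
Elem {a} {b} E = (Fin a ⊎ Fin b) ⊎ Edge E

size : ∀ {a b} → BGraph a b → ℕ
size {a} {b} E = a + b + numEdges E

-- a bijection g : V ∪ E → [1, p+q], encoded as a bijection onto Fin (p+q)
-- followed by the shift  x ↦ toℕ x + 1
Labeling : ∀ {a b} → BGraph a b → Set
Labeling E = Elem E ⤖ Fin (size E)

label : ∀ {a b} (E : BGraph a b) → Labeling E → Elem E → ℕ
label E g x = suc (toℕ (Bijection.to g x))

edgeWeight : ∀ {a b} (E : BGraph a b) → Labeling E → Edge E → ℕ
edgeWeight E g e@((i , j) , _) =
  label E g (inj₁ (inj₁ i)) + label E g (inj₂ e) + label E g (inj₁ (inj₂ j))

IsEdgeMagicWith : ∀ {a b} (E : BGraph a b) → Labeling E → ℕ → Set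
IsEdgeMagicWith E g k = ∀ (e : Edge E) → edgeWeight E g e ≡ k

IsEdgeMagic : ∀ {a b} → BGraph a b → Set
IsEdgeMagic E = ∃[ g ] ∃[ k ] IsEdgeMagicWith E g k

edgeLabelOr0 : ∀ {a b} (E : BGraph a b) → Labeling E → Fin a → Fin b → ℕ
edgeLabelOr0 E g i j = go (E i j) refl
  where
  go : (c : Bool) → E i j ≡ c → ℕ
  go true  p = label E g (inj₂ ((i , j) , p))
  go false _ = 0

-- q · (element of T_G determined by g):
--   Σ_{u ∈ V} deg(u) g(u) + Σ_{e ∈ E} g(e)
weightSum : ∀ {a b} (E : BGraph a b) → Labeling E → ℕ
weightSum {a} {b} E g =
    ∑ a (λ i → degL E i * label E g (inj₁ (inj₁ i)))
  + ∑ b (λ j → degR E j * label E g (inj₁ (inj₂ j)))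
  + ∑ a (λ i → ∑ b λ j → edgeLabelOr0 E g i j)

-- k ∈ J_G = [⌈min T_G⌉ , ⌊max T_G⌋], for an integer k, unfolds to
--   (∃ g. weightSum g / q ≤ k) and (∃ g. k ≤ weightSum g / q)
InJ : ∀ {a b} → BGraph a b → ℕ → Set
InJ E k = (∃[ g ] weightSum E g ≤ numEdges E * k)
        × (∃[ g ] numEdges E * k ≤ weightSum E g)

InTau : ∀ {a b} → BGraph a b → ℕ → Set
InTau E k = InJ E k × (∃[ g ] IsEdgeMagicWith E g k)

-- Decomposition G ≅ H₁ ⊕ H₂ (only the edge sets matter): E(H₁), E(H₂)
-- partition E(G).

IsDecomposition : ∀ {a b} → BGraph a b → BGraph a b → BGraph a b → Set
IsDecomposition G H₁ H₂ =
    (∀ i j → G i j ≡ true → (H₁ i j ≡ true) ⊎ (H₂ i j ≡ true))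
  × (∀ i j → H₁ i j ≡ true → G i j ≡ true)
  × (∀ i j → H₂ i j ≡ true → G i j ≡ true)
  × (∀ i j → H₁ i j ≡ true → H₂ i j ≡ false)

-- S_{2n}(G; H₁, H₂), as a bipartite graph with
--   left part  X ∪ X_1 ∪ … ∪ X_n  = Fin (s + n * s)
--     (splitAt s: inj₁ i ↦ x_i ; inj₂ r ↦ x_i^k where remQuot {n} s r = (k , i))
--   right part Y ∪ Y_1 ∪ … ∪ Y_n  = Fin (t + n * t)  (similarly)
-- edges: x_i y_j (G), x_i y_j^k (H₁), x_i^k y_j (H₂); no X_k–Y_l edges.

S2n : ∀ {s t} (n : ℕ) → BGraph s t → BGraph s t → BGraph s t
    → BGraph (s + n * s) (t + n * t)
S2n {s} {t} n G H₁ H₂ u v with splitAt s u | splitAt t v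
... | inj₁ i | inj₁ j = G i j
... | inj₁ i | inj₂ r = H₁ i (proj₂ (remQuot {n} t r))
... | inj₂ r | inj₁ j = H₂ (proj₂ (remQuot {n} s r)) j
... | inj₂ _ | inj₂ _ = false

-- |τ_B| ≥ f (|τ_A|) for the finite sets τ_A, τ_B ⊆ ℕ: every duplicate-free
-- list of elements of τ_A of length m can be matched by a duplicate-free
-- list of elements of τ_B of length ≥ f m.

CardGE : (ℕ → Set) → (ℕ → Set) → (ℕ → ℕ) → Set
CardGE P Q f = ∀ (L : List ℕ) → Unique L → All P L →
  ∃[ M ] (Unique M × All Q M × f (length L) ≤ length M)

{-# OPTIONS --safe #-}

-- Every element of G, of label l + 1, has n + 1 copies in S, with copy numbers
-- r ∈ [0, n].  Along the edges of S the copy numbers of the two vertices and of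
-- the edge can be made to have constant sum a + n, for any a ∈ [0, n].  Hence a
-- labelling of S by l α + r β is edge-magic of valence 3 + α w + β (a + n) if 3 + w
-- is the valence of G.  With α = n + 1, β = 1 this gives n + 1 valences of S for
-- each valence of G, all distinct.  The labels l of the elements lying on edges
-- are below M = min (p + q, w), so α = 1, β = M, a = 0 is also possible, up to
-- isolated vertices; for the least w it gives a smaller valence than all the
-- previous ones.  By complementation there is also a larger one.
module Submission where

open import Defs
open import Axiom.UniquenessOfIdentityProofs.WithK using (uip)
open import Data.Bool using (Bool; true; false)
import Data.Bool.Properties as Bool
open import Data.Empty using (⊥-elim)
open import Data.Fin using (Fin; zero; suc; toℕ; fromℕ<; opposite; splitAt; remQuot; combine; punchOut)
import Data.Fin.Properties as Fin
open import Data.Fin.Permutation.Components using (transpose; transpose-inverse)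
open import Data.List using (List; []; _∷_; map; allFin; length; cartesianProductWith; upTo)
open import Data.List.Membership.Propositional using (_∈_)
open import Data.List.Properties using (map-tabulate; length-map; length-tabulate; length-upTo; length-++)
open import Data.List.Relation.Unary.All as All using (All; []; _∷_)
import Data.List.Relation.Unary.All.Properties as All
open import Data.List.Relation.Unary.AllPairs using ([]; _∷_)
open import Data.List.Relation.Unary.Unique.Propositional using (Unique)
import Data.List.Relation.Unary.Unique.Propositional.Properties as Unique
open import Data.Nat using (ℕ; zero; suc; _+_; _*_; _≤_; _<_; _⊓_; z≤n; s≤s)
open import Data.Nat.ListAction using () renaming (sum to sumᴸ)
import Data.Nat.Properties as ℕ
open import Data.Nat.Tactic.RingSolver using (solve-∀)
open import Data.Product as Product using (Σ; ∃-syntax; _×_; _,_; proj₁; proj₂; uncurry)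
open import Data.Product.Algebra using (Σ-assoc)
import Data.Product.Function.Dependent.Propositional as Σ
open import Data.Product.Function.NonDependent.Propositional using (_×-cong_)
open import Data.Sum using (_⊎_; inj₁; inj₂)
open import Data.Sum.Function.Propositional using (_⊎-cong_)
open import Data.Unit using (⊤; tt)
open import Function.Base using (_∘_)
open import Function.Bundles using (_↔_; Inverse; Bijection; Injection; mk↔ₛ′; mk⤖)
open import Function.Definitions using (Injective; Surjective)
open import Function.Properties.Inverse using (↔-trans; ↔-sym; ↔-refl; ↔⇒↣)
open import Relation.Binary.Definitions using (Total)
open import Relation.Binary.PropositionalEquality using (setoid; _≡_; _≢_; refl; sym; trans; cong; cong₂; subst; module ≡-Reasoning)
open import Relation.Nullary using (¬_; Dec; yes; no)
open import Relation.Nullary.Decidable using (map′)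

open import Algebra.Properties.CommutativeMonoid.Sum ℕ.+-0-commutativeMonoid
  using (sum; sum-cong-≗; ∑-distrib-+; ∑-comm)
open import Algebra.Properties.Semiring.Sum ℕ.+-*-semiring
  using (*-distribʳ-sum)

∑-suc : ∀ m (f : Fin (suc m) → ℕ) → ∑ (suc m) f ≡ f zero + ∑ m (f ∘ suc)
∑-suc m f = cong (λ l → f zero + sumᴸ l)
  (trans (map-tabulate suc f) (sym (map-tabulate (λ i → i) (f ∘ suc))))

∑≡sum : ∀ m (f : Fin m → ℕ) → ∑ m f ≡ sum f
∑≡sum zero    f = refl
∑≡sum (suc m) f = trans (∑-suc m f) (cong (f zero +_) (∑≡sum m (f ∘ suc)))

∑∑≡sum : ∀ a b (f : Fin a → Fin b → ℕ) →
  ∑ a (λ i → ∑ b (f i)) ≡ sum (λ i → sum (f i))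
∑∑≡sum a b f = trans (∑≡sum a _) (sum-cong-≗ λ i → ∑≡sum b (f i))

-- edgeLabelOr0 is stuck on a local function applied to E i j and refl, and
-- abstracting E i j would also rewrite the left-hand side of the type of refl.
-- The dummy unit argument, x on that side and tt elsewhere, keeps the two
-- occurrences syntactically apart although they are convertible.
magic-cell : ∀ {a b} (E : ⊤ → BGraph a b) (x : ⊤) g i j k → IsEdgeMagicWith (E tt) g k →
  χ (E tt i j) * label (E tt) g (inj₁ (inj₁ i)) + χ (E tt i j) * label (E tt) g (inj₁ (inj₂ j))
    + edgeLabelOr0 (E tt) g i j ≡ χ (E tt i j) * k
magic-cell E x g i j k magic with E tt i j | refl-at E x i j
  where
  refl-at : ∀ {a b} (E : ⊤ → BGraph a b) x i j → E x i j ≡ E tt i j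
  refl-at E x i j = refl
... | false | _ = refl
... | true  | p = begin
  (u + 0) + (v + 0) + w ≡⟨ swapped u v w ⟩
  u + w + v             ≡⟨ magic ((i , j) , p) ⟩
  k                     ≡⟨ ℕ.+-identityʳ k ⟨
  k + 0                 ∎
  where
  open ≡-Reasoning
  u = label (E tt) g (inj₁ (inj₁ i))
  v = label (E tt) g (inj₁ (inj₂ j))
  w = label (E tt) g (inj₂ ((i , j) , p))
  swapped : ∀ u v w → (u + 0) + (v + 0) + w ≡ u + w + v
  swapped = solve-∀

weightSum-magic : ∀ {a b} (E : BGraph a b) g k → IsEdgeMagicWith E g k →
  weightSum E g ≡ numEdges E * k
weightSum-magic {a} {b} E g k magic = begin
  ∑ a (λ i → degL E i * u i) + ∑ b (λ j → degR E j * v j) + ∑ a (λ i → ∑ b λ j → w i j)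
    ≡⟨ cong₂ _+_ (cong₂ _+_ left right) (∑∑≡sum a b w) ⟩
  sum (λ i → sum λ j → c i j * u i) + sum (λ i → sum λ j → c i j * v j) + sum (λ i → sum λ j → w i j)
    ≡⟨ cong (_+ sum λ i → sum (w i)) (merge (λ i j → c i j * u i) (λ i j → c i j * v j)) ⟩
  sum (λ i → sum λ j → c i j * u i + c i j * v j) + sum (λ i → sum λ j → w i j)
    ≡⟨ merge (λ i j → c i j * u i + c i j * v j) w ⟩
  sum (λ i → sum λ j → c i j * u i + c i j * v j + w i j)
    ≡⟨ sum-cong-≗ (λ i → sum-cong-≗ λ j → magic-cell (λ _ → E) tt g i j k magic) ⟩
  sum (λ i → sum λ j → c i j * k)
    ≡⟨ sum-cong-≗ (λ i → *-distribʳ-sum k (c i)) ⟨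
  sum (λ i → sum (c i) * k)
    ≡⟨ *-distribʳ-sum k (λ i → sum (c i)) ⟨
  sum (λ i → sum (c i)) * k
    ≡⟨ cong (_* k) (∑∑≡sum a b c) ⟨
  numEdges E * k ∎
  where
  open ≡-Reasoning
  c : Fin a → Fin b → ℕ
  c i j = χ (E i j)
  u : Fin a → ℕ
  u i = label E g (inj₁ (inj₁ i))
  v : Fin b → ℕ
  v j = label E g (inj₁ (inj₂ j))
  w = edgeLabelOr0 E g
  merge : ∀ (f h : Fin a → Fin b → ℕ) →
    sum (λ i → sum (f i)) + sum (λ i → sum (h i)) ≡ sum (λ i → sum λ j → f i j + h i j)
  merge f h = trans (sym (∑-distrib-+ (λ i → sum (f i)) (λ i → sum (h i))))
    (sum-cong-≗ λ i → sym (∑-distrib-+ (f i) (h i)))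
  left : ∑ a (λ i → degL E i * u i) ≡ sum (λ i → sum λ j → c i j * u i)
  left = trans (∑≡sum a _) (sum-cong-≗ λ i →
    trans (cong (_* u i) (∑≡sum b (c i))) (*-distribʳ-sum (u i) (c i)))
  right : ∑ b (λ j → degR E j * v j) ≡ sum (λ i → sum λ j → c i j * v j)
  right = trans (∑≡sum b _) (trans
    (sum-cong-≗ λ j → trans (cong (_* v j) (∑≡sum a (λ i → c i j))) (*-distribʳ-sum (v j) (λ i → c i j)))
    (∑-comm (λ j i → c i j * v j)))

Magic : ∀ {a b} → BGraph a b → ℕ → Set
Magic E k = ∃[ g ] IsEdgeMagicWith E g k

magic⇒InTau : ∀ {a b} {E : BGraph a b} {k} → Magic E k → InTau E k
magic⇒InTau {E = E} {k} (g , magic) =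
  ((g , ℕ.≤-reflexive eq) , (g , ℕ.≤-reflexive (sym eq))) , (g , magic)
  where eq = weightSum-magic E g k magic

Σ-Fin : ∀ m (f : Fin m → ℕ) → Σ (Fin m) (Fin ∘ f) ↔ Fin (∑ m f)
Σ-Fin zero    f = mk↔ₛ′ (λ ()) (λ ()) (λ ()) (λ ())
Σ-Fin (suc m) f = subst (λ k → Σ (Fin (suc m)) (Fin ∘ f) ↔ Fin k) (sym (∑-suc m f))
  (↔-trans split (↔-trans (↔-refl ⊎-cong Σ-Fin m (f ∘ suc)) (↔-sym Fin.+↔⊎)))
  where
  split : Σ (Fin (suc m)) (Fin ∘ f) ↔ (Fin (f zero) ⊎ Σ (Fin m) (Fin ∘ f ∘ suc))
  split = mk↔ₛ′
    (λ { (zero , x) → inj₁ x ; (suc i , x) → inj₂ (i , x) })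
    (λ { (inj₁ x) → zero , x ; (inj₂ (i , x)) → suc i , x })
    (λ { (inj₁ x) → refl ; (inj₂ (i , x)) → refl })
    (λ { (zero , x) → refl ; (suc i , x) → refl })

χ-Fin : ∀ c → (c ≡ true) ↔ Fin (χ c)
χ-Fin true  = mk↔ₛ′ (λ _ → zero) (λ _ → refl) (λ { zero → refl }) (λ { refl → refl })
χ-Fin false = mk↔ₛ′ (λ ()) (λ ()) (λ ()) (λ ())

Edge↔Fin : ∀ {a b} (E : BGraph a b) → Edge E ↔ Fin (numEdges E)
Edge↔Fin {a} {b} E = ↔-trans Σ-assoc (↔-trans
  (Σ.congˡ λ {i} → ↔-trans (Σ.congˡ λ {j} → χ-Fin (E i j)) (Σ-Fin b (λ j → χ (E i j))))
  (Σ-Fin a (λ i → ∑ b λ j → χ (E i j))))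

Elem↔Fin : ∀ {a b} (E : BGraph a b) → Elem E ↔ Fin (size E)
Elem↔Fin E = ↔-trans (↔-sym Fin.+↔⊎ ⊎-cong Edge↔Fin E) (↔-sym Fin.+↔⊎)

injective⇒surjective : ∀ {m} (f : Fin m → Fin m) →
  Injective _≡_ _≡_ f → ∀ y → ∃[ x ] f x ≡ y
injective⇒surjective {suc m} f inj y with Fin.any? (λ x → f x Fin.≟ y)
... | yes hit = hit
... | no miss = ⊥-elim (ℕ.1+n≰n (Fin.injective⇒≤ {f = λ x → punchOut (y≢f x)}
        λ {x} {x′} eq → inj (Fin.punchOut-injective (y≢f x) (y≢f x′) eq)))
  where
  y≢f : ∀ x → y ≢ f x
  y≢f x eq = miss (x , sym eq)

labelWith : ∀ {a b} (E : BGraph a b) (f : Elem E → ℕ) →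
  (∀ z → f z < size E) → Injective _≡_ _≡_ f →
  ∃[ g ] (∀ z → label E g z ≡ suc (f z))
labelWith E f f< inj = mk⤖ (h-inj , h-surj) , λ z → cong suc (Fin.toℕ-fromℕ< (f< z))
  where
  open Inverse (Elem↔Fin E) using (from)
  h : Elem E → Fin (size E)
  h z = fromℕ< (f< z)
  h-inj : Injective _≡_ _≡_ h
  h-inj eq = inj (Fin.fromℕ<-injective _ _ (f< _) (f< _) eq)
  from-inj : Injective _≡_ _≡_ from
  from-inj = Injection.injective (↔⇒↣ (↔-sym (Elem↔Fin E)))
  h-surj : Surjective _≡_ _≡_ h
  h-surj y with injective⇒surjective (h ∘ from) (from-inj ∘ h-inj) y
  ... | x , eq = from x , λ { refl → eq }

toℕ+opposite : ∀ {m} (i : Fin m) → suc (toℕ i + toℕ (opposite i)) ≡ m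
toℕ+opposite i = trans (cong (suc (toℕ i) +_) (Fin.opposite-prop i)) (ℕ.m+[n∸m]≡n (Fin.toℕ<n i))

opposite-injective : ∀ {m} → Injective _≡_ _≡_ (opposite {m})
opposite-injective {x = i} {j} eq =
  trans (sym (Fin.opposite-involutive i)) (trans (cong opposite eq) (Fin.opposite-involutive j))

magic-complement : ∀ {a b} {E : BGraph a b} {k} → Edge E → Magic E k →
  ∃[ k′ ] (Magic E k′ × k + k′ ≡ 3 * suc (size E))
magic-complement {E = E} {k} e₀ (g , magic) =
  edgeWeight E g′ e₀ , (g′ , magic′) , complementary e₀
  where
  open Bijection g using (to; injective)
  relabelled = labelWith E (λ z → toℕ (opposite (to z))) (λ z → Fin.toℕ<n (opposite (to z)))
    (injective ∘ opposite-injective ∘ Fin.toℕ-injective)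
  g′ = proj₁ relabelled
  label-sum : ∀ z → label E g z + label E g′ z ≡ suc (size E)
  label-sum z = begin
    suc (toℕ (to z)) + label E g′ z                       ≡⟨ cong (suc (toℕ (to z)) +_) (proj₂ relabelled z) ⟩
    suc (toℕ (to z)) + suc (toℕ (opposite (to z)))        ≡⟨ ℕ.+-suc (suc (toℕ (to z))) _ ⟩
    suc (suc (toℕ (to z) + toℕ (opposite (to z))))        ≡⟨ cong suc (toℕ+opposite (to z)) ⟩
    suc (size E)                                          ∎
    where open ≡-Reasoning
  complementary : ∀ e → k + edgeWeight E g′ e ≡ 3 * suc (size E)
  complementary e@((i , j) , _) = begin
    k + edgeWeight E g′ e                     ≡⟨ cong (_+ edgeWeight E g′ e) (magic e) ⟨
    edgeWeight E g e + edgeWeight E g′ e      ≡⟨ interleave (l x) (l y) (l z) (l′ x) (l′ y) (l′ z) ⟩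
    (l x + l′ x) + (l y + l′ y) + (l z + l′ z)
      ≡⟨ cong₂ _+_ (cong₂ _+_ (label-sum x) (label-sum y)) (label-sum z) ⟩
    suc (size E) + suc (size E) + suc (size E) ≡⟨ triple (suc (size E)) ⟩
    3 * suc (size E)                          ∎
    where
    open ≡-Reasoning
    l = label E g
    l′ = label E g′
    x y z : Elem E
    x = inj₁ (inj₁ i)
    y = inj₂ e
    z = inj₁ (inj₂ j)
    interleave : ∀ a b c a′ b′ c′ → (a + b + c) + (a′ + b′ + c′) ≡ (a + a′) + (b + b′) + (c + c′)
    interleave = solve-∀
    triple : ∀ m → m + m + m ≡ 3 * m
    triple = solve-∀
  magic′ : IsEdgeMagicWith E g′ (edgeWeight E g′ e₀)
  magic′ e = ℕ.+-cancelˡ-≡ k _ _ (trans (complementary e) (sym (complementary e₀)))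

Edge-≡ : ∀ {a b} {E : BGraph a b} {e e′ : Edge E} → proj₁ e ≡ proj₁ e′ → e ≡ e′
Edge-≡ {e = _ , p} {_ , p′} refl = cong (_ ,_) (uip p p′)

remQuot-injective : ∀ {m} k → Injective _≡_ _≡_ (remQuot {m} k)
remQuot-injective {m} k {x} {y} eq = trans (sym (Fin.combine-remQuot {m} k x))
  (trans (cong (uncurry combine) eq) (Fin.combine-remQuot {m} k y))

transpose-injective : ∀ {m} (i j : Fin m) → Injective _≡_ _≡_ (transpose i j)
transpose-injective i j {x} {y} eq = trans (sym (transpose-inverse j i))
  (trans (cong (transpose j i) eq) (transpose-inverse j i))

-- A bijection from [0, N) × [0, n] to [0, (n+1) N) provided M ≤ N: the copy is
-- the high digit for labels below M and the low digit for the others.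
digits : ∀ {N} n (M : ℕ) → Fin N → Fin (suc n) → ℕ
digits n M l r with toℕ l ℕ.<? M
... | yes l<M = toℕ (combine r (fromℕ< l<M))
... | no  _   = toℕ (combine l r)

digits-low : ∀ {N} n M (l : Fin N) r → toℕ l < M → digits n M l r ≡ 1 * toℕ l + M * toℕ r
digits-low n M l r l<M with toℕ l ℕ.<? M
... | yes p = begin
  toℕ (combine r (fromℕ< p))     ≡⟨ Fin.toℕ-combine r (fromℕ< p) ⟩
  M * toℕ r + toℕ (fromℕ< p)     ≡⟨ cong (M * toℕ r +_) (Fin.toℕ-fromℕ< p) ⟩
  M * toℕ r + toℕ l              ≡⟨ ℕ.+-comm (M * toℕ r) (toℕ l) ⟩
  toℕ l + M * toℕ r              ≡⟨ cong (_+ M * toℕ r) (ℕ.*-identityˡ (toℕ l)) ⟨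
  1 * toℕ l + M * toℕ r          ∎
  where open ≡-Reasoning
... | no ¬p = ⊥-elim (¬p l<M)

digits-high : ∀ {N} n (l : Fin N) r → digits n 0 l r ≡ suc n * toℕ l + 1 * toℕ r
digits-high n l r = trans (Fin.toℕ-combine l r) (cong (suc n * toℕ l +_) (sym (ℕ.*-identityˡ (toℕ r))))

digits-bound : ∀ {N} n {M} → M ≤ N → ∀ (l : Fin N) r → digits n M l r < suc n * N
digits-bound {N} n {M} M≤N l r with toℕ l ℕ.<? M
... | yes p = ℕ.<-≤-trans (Fin.toℕ<n (combine r (fromℕ< p))) (ℕ.*-monoʳ-≤ (suc n) M≤N)
... | no  _ = subst (toℕ (combine l r) <_) (ℕ.*-comm N (suc n)) (Fin.toℕ<n (combine l r))

low<high : ∀ {N n M} (r : Fin (suc n)) (l : Fin M) (l′ : Fin N) (r′ : Fin (suc n)) →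
  ¬ toℕ l′ < M → toℕ (combine r l) < toℕ (combine l′ r′)
low<high {N} {n} {M} r l l′ r′ ¬l′<M = begin-strict
  toℕ (combine r l)          <⟨ Fin.toℕ<n (combine r l) ⟩
  suc n * M                  ≤⟨ ℕ.*-monoʳ-≤ (suc n) (ℕ.≮⇒≥ ¬l′<M) ⟩
  suc n * toℕ l′             ≤⟨ ℕ.m≤m+n _ (toℕ r′) ⟩
  suc n * toℕ l′ + toℕ r′    ≡⟨ Fin.toℕ-combine l′ r′ ⟨
  toℕ (combine l′ r′)        ∎
  where open ℕ.≤-Reasoning

digits-injective : ∀ {N} n M {l l′ : Fin N} {r r′} →
  digits n M l r ≡ digits n M l′ r′ → l ≡ l′ × r ≡ r′
digits-injective {N} n M {l} {l′} {r} {r′} eq with toℕ l ℕ.<? M | toℕ l′ ℕ.<? M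
... | yes p | yes p′ with eqr , eql ← Fin.combine-injective r (fromℕ< p) r′ (fromℕ< p′) (Fin.toℕ-injective eq)
  = Fin.toℕ-injective (Fin.fromℕ<-injective _ _ p p′ eql) , eqr
... | no _ | no _ = Fin.combine-injective l r l′ r′ (Fin.toℕ-injective eq)
... | yes p | no ¬p = ⊥-elim (ℕ.<⇒≢ (low<high r (fromℕ< p) l′ r′ ¬p) eq)
... | no ¬p | yes p = ⊥-elim (ℕ.<⇒≢ (low<high r′ (fromℕ< p) l r ¬p) (sym eq))

length-cartesianProductWith : ∀ {A B C : Set} (f : A → B → C) xs ys →
  length (cartesianProductWith f xs ys) ≡ length xs * length ys
length-cartesianProductWith f []       ys = refl
length-cartesianProductWith f (x ∷ xs) ys = trans (length-++ (map (f x) ys))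
  (cong₂ _+_ (length-map (f x) ys) (length-cartesianProductWith f xs ys))

extremum : ∀ {P Q : ℕ → Set} {_≼_ D : ℕ → ℕ → Set} → Total _≼_ →
  (∀ {k k′ w} → k ≼ k′ → D k′ w → D k w) →
  (∀ {w} → P w → ∃[ k ] (Q k × D k w)) →
  ∀ {w L} → All P (w ∷ L) → ∃[ k ] (Q k × All (D k) (w ∷ L))
extremum total mono step (p ∷ []) with step p
... | k , q , d = k , q , d ∷ []
extremum total mono step (p ∷ ps@(_ ∷ _)) with step p | extremum total mono step ps
... | k , q , d | k′ , q′ , ds with total k k′
... | inj₁ k≼k′ = k , q , d ∷ All.map (mono k≼k′) ds
... | inj₂ k′≼k = k′ , q′ , mono k′≼k d ∷ ds

complement-larger : ∀ n w w′ {N T c u u′} → c ≤ n →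
  (3 + w) + (3 + w′) ≡ 3 * suc N → u′ < 3 + (suc n * w′ + 1 * (0 + n)) →
  u′ + u ≡ 3 * suc T → suc n * N ≤ T → 3 + (suc n * w + 1 * (c + n)) < u
complement-larger n w w′ {N} {T} {c} {u} {u′} c≤n sum-N u′< sum-T N≤T = ℕ.+-cancelˡ-< u′ _ _ (begin-strict
  u′ + (3 + (suc n * w + 1 * (c + n)))
    <⟨ ℕ.+-mono-<-≤ u′< (ℕ.+-monoʳ-≤ 3 (ℕ.+-monoʳ-≤ (suc n * w) (ℕ.*-monoʳ-≤ 1 (ℕ.+-monoˡ-≤ n c≤n)))) ⟩
  (3 + (suc n * w′ + 1 * (0 + n))) + (3 + (suc n * w + 1 * (n + n)))
    ≡⟨ regroup n w w′ ⟩
  3 + suc n * (3 + (w + w′))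
    ≡⟨ cong (λ m → 3 + suc n * m) w+w′ ⟩
  3 + suc n * (3 * N)
    ≡⟨ factor n N ⟩
  3 * suc (suc n * N)
    ≤⟨ ℕ.*-monoʳ-≤ 3 (s≤s N≤T) ⟩
  3 * suc T
    ≡⟨ sum-T ⟨
  u′ + u ∎)
  where
  open ℕ.≤-Reasoning
  regroup : ∀ n w w′ → (3 + (suc n * w′ + 1 * (0 + n))) + (3 + (suc n * w + 1 * (n + n)))
    ≡ 3 + suc n * (3 + (w + w′))
  regroup = solve-∀
  factor : ∀ n N → 3 + suc n * (3 * N) ≡ 3 * suc (suc n * N)
  factor = solve-∀
  shift : ∀ w w′ → 3 + (3 + (w + w′)) ≡ (3 + w) + (3 + w′)
  shift = solve-∀
  w+w′ : 3 + (w + w′) ≡ 3 * N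
  w+w′ = ℕ.+-cancelˡ-≡ 3 _ _ (trans (shift w w′) (trans sum-N (ℕ.*-suc 3 N)))

module Blowup {s t : ℕ} (n : ℕ) (G H₁ H₂ : BGraph s t) (decomposition : IsDecomposition G H₁ H₂) where

  S : BGraph (s + n * s) (t + n * t)
  S = S2n n G H₁ H₂

  -- Copy 0 of a vertex is the original one, copy k its k-th duplicate.
  Copy : ℕ → Set
  Copy m = Fin (suc n) × Fin m

  copyˡ : Fin (s + n * s) → Copy s
  copyˡ = remQuot {suc n} s

  copyʳ : Fin (t + n * t) → Copy t
  copyʳ = remQuot {suc n} t

  cell : Copy s → Copy t → Bool
  cell (zero  , i) (zero  , j) = G i j
  cell (zero  , i) (suc _ , j) = H₁ i j
  cell (suc _ , i) (zero  , j) = H₂ i j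
  cell (suc _ , _) (suc _ , _) = false

  S-cell : ∀ u v → S u v ≡ cell (copyˡ u) (copyʳ v)
  S-cell u v with splitAt s u | splitAt t v
  ... | inj₁ _ | inj₁ _ = refl
  ... | inj₁ _ | inj₂ _ = refl
  ... | inj₂ _ | inj₁ _ = refl
  ... | inj₂ _ | inj₂ _ = refl

  H₁⊆G : ∀ i j → H₁ i j ≡ true → G i j ≡ true
  H₁⊆G = proj₁ (proj₂ decomposition)

  H₂⊆G : ∀ i j → H₂ i j ≡ true → G i j ≡ true
  H₂⊆G = proj₁ (proj₂ (proj₂ decomposition))

  disjoint : ∀ {i j} {A : Set} → H₁ i j ≡ true → H₂ i j ≡ true → A
  disjoint {i} {j} p q with trans (sym q) (proj₂ (proj₂ (proj₂ decomposition)) i j p)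
  ... | ()

  cell⊆G : ∀ x y → cell x y ≡ true → G (proj₂ x) (proj₂ y) ≡ true
  cell⊆G (zero  , i) (zero  , j) p = p
  cell⊆G (zero  , i) (suc _ , j) p = H₁⊆G i j p
  cell⊆G (suc _ , i) (zero  , j) p = H₂⊆G i j p

  _⊔₀_ : Fin (suc n) → Fin (suc n) → Fin (suc n)
  zero  ⊔₀ r = r
  suc q ⊔₀ _ = suc q

  cell-injective : ∀ {i j} q r q′ r′ →
    cell (q , i) (r , j) ≡ true → cell (q′ , i) (r′ , j) ≡ true →
    q ⊔₀ r ≡ q′ ⊔₀ r′ → q ≡ q′ × r ≡ r′
  cell-injective zero    zero    zero    zero    p p′ eq = refl , refl
  cell-injective zero    (suc _) zero    (suc _) p p′ eq = refl , eq
  cell-injective (suc _) zero    (suc _) zero    p p′ eq = eq , refl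
  cell-injective zero    (suc _) (suc _) zero    p p′ eq = disjoint p p′
  cell-injective (suc _) zero    zero    (suc _) p p′ eq = disjoint p′ p

  edge-cell : (e : Edge S) → cell (copyˡ (proj₁ (proj₁ e))) (copyʳ (proj₂ (proj₁ e))) ≡ true
  edge-cell ((u , v) , p) = trans (sym (S-cell u v)) p

  baseEdge : Edge S → Edge G
  baseEdge e@((u , v) , _) =
    (proj₂ (copyˡ u) , proj₂ (copyʳ v)) , cell⊆G (copyˡ u) (copyʳ v) (edge-cell e)

  edgeCopy : Edge S → Fin (suc n)
  edgeCopy ((u , v) , _) = proj₁ (copyˡ u) ⊔₀ proj₁ (copyʳ v)

  project : Elem S → Fin (suc n) × Elem G
  project (inj₁ (inj₁ u)) = proj₁ (copyˡ u) , inj₁ (inj₁ (proj₂ (copyˡ u)))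
  project (inj₁ (inj₂ v)) = proj₁ (copyʳ v) , inj₁ (inj₂ (proj₂ (copyʳ v)))
  project (inj₂ e)        = edgeCopy e , inj₂ (baseEdge e)

  project-injective : Injective _≡_ _≡_ project
  project-injective {inj₁ (inj₁ u)} {inj₁ (inj₁ u′)} eq =
    cong (inj₁ ∘ inj₁) (remQuot-injective {suc n} s (left eq))
    where
    left : ∀ {x y : Copy s} → _≡_ {A = Fin (suc n) × Elem G}
      (proj₁ x , inj₁ (inj₁ (proj₂ x))) (proj₁ y , inj₁ (inj₁ (proj₂ y))) → x ≡ y
    left refl = refl
  project-injective {inj₁ (inj₂ v)} {inj₁ (inj₂ v′)} eq =
    cong (inj₁ ∘ inj₂) (remQuot-injective {suc n} t (right eq))
    where
    right : ∀ {x y : Copy t} → _≡_ {A = Fin (suc n) × Elem G}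
      (proj₁ x , inj₁ (inj₂ (proj₂ x))) (proj₁ y , inj₁ (inj₂ (proj₂ y))) → x ≡ y
    right refl = refl
  project-injective {inj₂ e} {inj₂ e′} eq = cong inj₂ (Edge-≡ (edge e e′ (cong proj₁ eq) (ends (cong proj₂ eq))))
    where
    ends : ∀ {f f′ : Edge G} → _≡_ {A = Elem G} (inj₂ f) (inj₂ f′) → proj₁ f ≡ proj₁ f′
    ends refl = refl
    copies : ∀ x y x′ y′ → cell x y ≡ true → cell x′ y′ ≡ true →
      proj₁ x ⊔₀ proj₁ y ≡ proj₁ x′ ⊔₀ proj₁ y′ →
      (proj₂ x , proj₂ y) ≡ (proj₂ x′ , proj₂ y′) → x ≡ x′ × y ≡ y′
    copies (q , i) (r , j) (q′ , _) (r′ , _) p p′ eq refl with cell-injective q r q′ r′ p p′ eq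
    ... | refl , refl = refl , refl
    edge : ∀ e e′ → edgeCopy e ≡ edgeCopy e′ → proj₁ (baseEdge e) ≡ proj₁ (baseEdge e′) → proj₁ e ≡ proj₁ e′
    edge e@((u , v) , _) e′@((u′ , v′) , _) eq eq′
      with copies (copyˡ u) (copyʳ v) (copyˡ u′) (copyʳ v′) (edge-cell e) (edge-cell e′) eq eq′
    ... | equ , eqv = cong₂ _,_ (remQuot-injective {suc n} s equ) (remQuot-injective {suc n} t eqv)
  project-injective {inj₁ (inj₁ _)} {inj₁ (inj₂ _)} eq with () ← cong proj₂ eq
  project-injective {inj₁ (inj₂ _)} {inj₁ (inj₁ _)} eq with () ← cong proj₂ eq
  project-injective {inj₁ (inj₁ _)} {inj₂ _} eq with () ← cong proj₂ eq
  project-injective {inj₁ (inj₂ _)} {inj₂ _} eq with () ← cong proj₂ eq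
  project-injective {inj₂ _} {inj₁ (inj₁ _)} eq with () ← cong proj₂ eq
  project-injective {inj₂ _} {inj₁ (inj₂ _)} eq with () ← cong proj₂ eq

  copyˡ-combine : ∀ x → copyˡ (uncurry combine x) ≡ x
  copyˡ-combine (r , i) = Fin.remQuot-combine {suc n} r i

  copyʳ-combine : ∀ y → copyʳ (uncurry combine y) ≡ y
  copyʳ-combine (r , j) = Fin.remQuot-combine {suc n} r j

  edgeAt : ∀ x y → cell x y ≡ true → Edge S
  edgeAt x y p = (uncurry combine x , uncurry combine y) ,
    trans (S-cell _ _) (trans (cong₂ cell (copyˡ-combine x) (copyʳ-combine y)) p)

  project-edgeAt : ∀ x y p →
    project (inj₂ (edgeAt x y p)) ≡ (proj₁ x ⊔₀ proj₁ y , inj₂ ((proj₂ x , proj₂ y) , cell⊆G x y p))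
  project-edgeAt x y p = cong₂ _,_
    (cong₂ _⊔₀_ (cong proj₁ (copyˡ-combine x)) (cong proj₁ (copyʳ-combine y)))
    (cong inj₂ (Edge-≡ (cong₂ _,_ (cong proj₂ (copyˡ-combine x)) (cong proj₂ (copyʳ-combine y)))))

  project-surjective : ∀ z → ∃[ x ] project x ≡ z
  project-surjective (r , inj₁ (inj₁ i)) = inj₁ (inj₁ (combine r i)) ,
    cong (λ x → proj₁ x , inj₁ (inj₁ (proj₂ x))) (copyˡ-combine (r , i))
  project-surjective (r , inj₁ (inj₂ j)) = inj₁ (inj₂ (combine r j)) ,
    cong (λ y → proj₁ y , inj₁ (inj₂ (proj₂ y))) (copyʳ-combine (r , j))
  project-surjective (zero , inj₂ ((i , j) , p)) =
    inj₂ (edgeAt (zero , i) (zero , j) p) , project-edgeAt (zero , i) (zero , j) p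
  project-surjective (suc k , inj₂ ((i , j) , p)) with proj₁ decomposition i j p
  ... | inj₁ q = inj₂ (edgeAt (zero , i) (suc k , j) q) ,
    trans (project-edgeAt (zero , i) (suc k , j) q) (cong (λ e → suc k , inj₂ e) (Edge-≡ refl))
  ... | inj₂ q = inj₂ (edgeAt (suc k , i) (zero , j) q) ,
    trans (project-edgeAt (suc k , i) (zero , j) q) (cong (λ e → suc k , inj₂ e) (Edge-≡ refl))

  size-S≥ : suc n * size G ≤ size S
  size-S≥ = Fin.injective⇒≤ {f = to ∘ section ∘ cellOf}
    (cellOf-injective ∘ section-injective ∘ Injection.injective (↔⇒↣ (Elem↔Fin S)))
    where
    open Inverse (Elem↔Fin S) using (to)
    cells = ↔-trans (Fin.*↔× {suc n} {size G}) (↔-refl ×-cong ↔-sym (Elem↔Fin G))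
    cellOf = Inverse.to cells
    cellOf-injective : Injective _≡_ _≡_ cellOf
    cellOf-injective = Injection.injective (↔⇒↣ cells)
    section : Fin (suc n) × Elem G → Elem S
    section = proj₁ ∘ project-surjective
    section-injective : Injective _≡_ _≡_ section
    section-injective {z} {z′} eq = trans (sym (proj₂ (project-surjective z)))
      (trans (cong project eq) (proj₂ (project-surjective z′)))

  -- Permute the copies of each vertex so that the original gets index a, and
  -- those of each edge by the reverse permutation.  Every edge of S has an
  -- original end, of index a; the indices of the other end and of the edge add to n.
  blowup : ∀ w (a : Fin (suc n)) α β (φ : Fin (size G) → Fin (suc n) → ℕ) →
    (∀ l r → φ l r < suc n * size G) →
    (∀ {l r l′ r′} → φ l r ≡ φ l′ r′ → l ≡ l′ × r ≡ r′) →
    (∀ l r → toℕ l < w → φ l r ≡ α * toℕ l + β * toℕ r) →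
    Magic G (3 + w) → Magic S (3 + (α * w + β * (toℕ a + n)))
  blowup w a α β φ φ< φ-injective φ-affine (f , magic) = g , magic-S
    where
    open Bijection f using (to; injective)

    τ : Fin (suc n) → Fin (suc n)
    τ = transpose zero a

    index : Elem G → Fin (suc n) → Fin (suc n)
    index (inj₁ _) r = τ r
    index (inj₂ _) r = opposite (τ r)

    index-injective : ∀ z → Injective _≡_ _≡_ (index z)
    index-injective (inj₁ _) = transpose-injective zero a
    index-injective (inj₂ _) = transpose-injective zero a ∘ opposite-injective

    spread : Fin (suc n) × Elem G → ℕ
    spread (r , z) = φ (to z) (index z r)

    spread-injective : Injective _≡_ _≡_ spread
    spread-injective {r , z} {r′ , z′} eq with φ-injective eq
    ... | eqz , eqr with refl ← injective eqz = cong (_, z) (index-injective z eqr)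

    labelled = labelWith S (spread ∘ project)
      (λ x → ℕ.<-≤-trans (φ< _ _) size-S≥) (project-injective ∘ spread-injective)
    g = proj₁ labelled

    base-sum : ∀ (e : Edge G) → let ((i , j) , _) = e in
      toℕ (to (inj₁ (inj₁ i))) + toℕ (to (inj₂ e)) + toℕ (to (inj₁ (inj₂ j))) ≡ w
    base-sum e@((i , j) , _) = ℕ.+-cancelˡ-≡ 3 _ _ (trans (shift _ _ _) (magic e))
      where
      shift : ∀ x y z → 3 + (x + y + z) ≡ suc x + suc y + suc z
      shift = solve-∀

    edge-sum : ∀ (e : Edge G) q r → q ≡ zero ⊎ r ≡ zero → let ((i , j) , _) = e in
      suc (spread (q , inj₁ (inj₁ i))) + suc (spread (q ⊔₀ r , inj₂ e)) + suc (spread (r , inj₁ (inj₂ j)))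
        ≡ 3 + (α * w + β * (toℕ a + n))
    edge-sum e@((i , j) , _) q r q0r0 = begin
      suc (φ lx (τ q)) + suc (φ le (opposite (τ (q ⊔₀ r)))) + suc (φ ly (τ r))
        ≡⟨ cong₂ _+_ (cong₂ (λ x y → suc x + suc y) (φ-affine lx _ lx<w) (φ-affine le _ le<w)) (cong suc (φ-affine ly _ ly<w)) ⟩
      suc (α * toℕ lx + β * A) + suc (α * toℕ le + β * B) + suc (α * toℕ ly + β * C)
        ≡⟨ collect α β (toℕ lx) (toℕ le) (toℕ ly) A B C ⟩
      3 + (α * (toℕ lx + toℕ le + toℕ ly) + β * (A + B + C))
        ≡⟨ cong₂ (λ x y → 3 + (α * x + β * y)) (base-sum e) (indices q r q0r0) ⟩
      3 + (α * w + β * (toℕ a + n)) ∎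
      where
      open ≡-Reasoning
      lx = to (inj₁ (inj₁ i))
      le = to (inj₂ e)
      ly = to (inj₁ (inj₂ j))
      A = toℕ (τ q)
      B = toℕ (opposite (τ (q ⊔₀ r)))
      C = toℕ (τ r)
      collect : ∀ α β x y z A B C →
        suc (α * x + β * A) + suc (α * y + β * B) + suc (α * z + β * C)
          ≡ 3 + (α * (x + y + z) + β * (A + B + C))
      collect = solve-∀
      indices : ∀ q r → q ≡ zero ⊎ r ≡ zero →
        toℕ (τ q) + toℕ (opposite (τ (q ⊔₀ r))) + toℕ (τ r) ≡ toℕ a + n
      indices zero r _ = trans (ℕ.+-assoc (toℕ a) _ _)
        (cong (toℕ a +_) (trans (ℕ.+-comm (toℕ (opposite (τ r))) (toℕ (τ r))) (ℕ.suc-injective (toℕ+opposite (τ r)))))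
      indices (suc q) zero _ = trans (cong (_+ toℕ a) (ℕ.suc-injective (toℕ+opposite (τ (suc q)))))
        (ℕ.+-comm n (toℕ a))
      indices (suc q) (suc r) (inj₁ ())
      indices (suc q) (suc r) (inj₂ ())
      below : ∀ x z z′ → z ≢ z′ → x + (toℕ (to z) + toℕ (to z′)) ≡ w → x < w
      below x z z′ z≢z′ eq = subst (x <_) eq (ℕ.m<m+n x (ℕ.n≢0⇒n>0 λ eq₀ → z≢z′ (injective (Fin.toℕ-injective
        (trans (ℕ.m+n≡0⇒m≡0 _ eq₀) (sym (ℕ.m+n≡0⇒n≡0 (toℕ (to z)) eq₀)))))))
      lx<w : toℕ lx < w
      lx<w = below (toℕ lx) (inj₂ e) (inj₁ (inj₂ j)) (λ ()) (trans (sym (ℕ.+-assoc (toℕ lx) _ _)) (base-sum e))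
      le<w : toℕ le < w
      le<w = below (toℕ le) (inj₁ (inj₁ i)) (inj₁ (inj₂ j)) (λ ()) (trans (rotate (toℕ le) (toℕ lx) _) (base-sum e))
        where
        rotate : ∀ x y z → x + (y + z) ≡ y + x + z
        rotate = solve-∀
      ly<w : toℕ ly < w
      ly<w = below (toℕ ly) (inj₁ (inj₁ i)) (inj₂ e) (λ ()) (trans (ℕ.+-comm (toℕ ly) _) (base-sum e))

    original : ∀ x y → cell x y ≡ true → proj₁ x ≡ zero ⊎ proj₁ y ≡ zero
    original (zero , _) y          p = inj₁ refl
    original (suc _ , _) (zero , _) p = inj₂ refl

    magic-S : IsEdgeMagicWith S g (3 + (α * w + β * (toℕ a + n)))
    magic-S e@((u , v) , _) = trans
      (cong₂ _+_ (cong₂ _+_ (proj₂ labelled (inj₁ (inj₁ u))) (proj₂ labelled (inj₂ e))) (proj₂ labelled (inj₁ (inj₂ v))))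
      (edge-sum (baseEdge e) (proj₁ (copyˡ u)) (proj₁ (copyʳ v)) (original (copyˡ u) (copyʳ v) (edge-cell e)))


  spreadValence : ℕ → Fin (suc n) → ℕ
  spreadValence w a = 3 + (suc n * w + 1 * (toℕ a + n))

  spreadValence-injective : ∀ {w w′ a a′} → spreadValence w a ≡ spreadValence w′ a′ → w ≡ w′ × a ≡ a′
  spreadValence-injective {w} {w′} {a} {a′} eq =
    Product.map₁ (λ eqw → trans (sym (Fin.toℕ-fromℕ< w<)) (trans (cong toℕ eqw) (Fin.toℕ-fromℕ< w′<)))
      (Fin.combine-injective (fromℕ< w<) a (fromℕ< w′<) a′ (Fin.toℕ-injective
        (trans (value w< a) (trans eq′ (sym (value w′< a′))))))
    where
    w<  = s≤s (ℕ.m≤m⊔n w w′)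
    w′< = s≤s (ℕ.m≤n⊔m w w′)
    value : ∀ {w m} (w<m : w < m) (a : Fin (suc n)) → toℕ (combine (fromℕ< w<m) a) ≡ suc n * w + toℕ a
    value w<m a = trans (Fin.toℕ-combine (fromℕ< w<m) a)
      (cong (λ x → suc n * x + toℕ a) (Fin.toℕ-fromℕ< w<m))
    shift : ∀ n w a → 3 + (suc n * w + 1 * (a + n)) ≡ (3 + n) + (suc n * w + a)
    shift = solve-∀
    eq′ : suc n * w + toℕ a ≡ suc n * w′ + toℕ a′
    eq′ = ℕ.+-cancelˡ-≡ (3 + n) _ _ (trans (sym (shift n w (toℕ a))) (trans eq (shift n w′ (toℕ a′))))

  spread-magic : ∀ {w} → Magic G (3 + w) → ∀ a → Magic S (spreadValence w a)
  spread-magic {w} magic a = blowup w a (suc n) 1 (digits n 0)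
    (digits-bound n z≤n) (digits-injective n 0) (λ l r _ → digits-high n l r) magic

  low-magic : 1 ≤ n → ∀ {w} → Magic G (3 + w) →
    ∃[ k ] (Magic S k × k < spreadValence w zero)
  low-magic 1≤n {w} magic = _ , blowup w zero 1 M (digits n M)
    (digits-bound n (ℕ.m⊓n≤m (size G) w)) (digits-injective n M)
    (λ l r l<w → digits-low n M l r (ℕ.⊓-pres-m< (Fin.toℕ<n l) l<w)) magic , smaller
    where
    M = size G ⊓ w
    smaller : 3 + (1 * w + M * (0 + n)) < 3 + (suc n * w + 1 * (0 + n))
    smaller = begin-strict
      3 + (1 * w + M * n)     ≤⟨ ℕ.+-monoʳ-≤ 3 (ℕ.+-monoʳ-≤ (1 * w) (ℕ.*-monoˡ-≤ n (ℕ.m⊓n≤n (size G) w))) ⟩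
      3 + (1 * w + w * n)     ≡⟨ factor n w ⟩
      3 + (suc n * w + 0)     <⟨ ℕ.+-monoʳ-< 3 (ℕ.+-monoʳ-< (suc n * w) (ℕ.≤-trans 1≤n (ℕ.≤-reflexive (sym (ℕ.*-identityˡ n))))) ⟩
      3 + (suc n * w + 1 * n) ∎
      where
      open ℕ.≤-Reasoning
      factor : ∀ n w → 3 + (1 * w + w * n) ≡ 3 + (suc n * w + 0)
      factor = solve-∀

  magic≥3 : Edge G → ∀ {v} → Magic G v → ∃[ w ] v ≡ 3 + w
  magic≥3 e@((i , j) , _) (g , magic) = _ , trans (sym (magic e)) (shift _ _ _)
    where
    shift : ∀ x y z → suc x + suc y + suc z ≡ 3 + (x + y + z)
    shift = solve-∀

  module _ (1≤n : 1 ≤ n) (eG : Edge G) where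

    eS : Edge S
    eS = edgeAt (zero , proj₁ (proj₁ eG)) (zero , proj₂ (proj₁ eG)) (proj₂ eG)

    -- The complement of the low labeling of the complement.
    high-magic : ∀ {w} → Magic G (3 + w) →
      ∃[ k ] (Magic S k × (∀ a → spreadValence w a < k))
    high-magic {w} magic = proj₁ high , proj₁ (proj₂ high) , λ a →
      complement-larger n w (proj₁ offset) (ℕ.<⇒≤pred (Fin.toℕ<n a))
        (trans (cong (3 + w +_) (sym (proj₂ offset))) (proj₂ (proj₂ dual)))
        (proj₂ (proj₂ low)) (proj₂ (proj₂ high)) size-S≥
      where
      dual = magic-complement eG magic
      offset = magic≥3 eG (proj₁ (proj₂ dual))
      low = low-magic 1≤n (subst (Magic G) (proj₂ offset) (proj₁ (proj₂ dual)))
      high = magic-complement eS (proj₁ (proj₂ low))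

    magic⇒CardGE : ∀ w L → Unique (w ∷ L) → All (λ w → Magic G (3 + w)) (w ∷ L) →
      ∃[ K ] (Unique K × All (InTau S) K × suc n * length (w ∷ L) + 2 ≤ length K)
    magic⇒CardGE w L unique magics = lo ∷ hi ∷ middle
      , ((lo≢hi ∷ spread-all λ w∈L a → ℕ.<⇒≢ (lo<spread w∈L a))
        ∷ (spread-all λ w∈L a → ℕ.<⇒≢ (All.lookup hi> w∈L a) ∘ sym)
        ∷ Unique.cartesianProductWith⁺ spreadValence spreadValence-injective unique (Unique.allFin⁺ (suc n)))
      , All.map magic⇒InTau (proj₁ (proj₂ low) ∷ proj₁ (proj₂ high)
          ∷ spread-all λ w∈L a → spread-magic (All.lookup magics w∈L) a)
      , ℕ.≤-reflexive (trans (ℕ.+-comm _ 2) (cong (2 +_) (sym length-middle)))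
      where
      low = extremum {Q = Magic S} {_≼_ = _≤_} {D = λ k w → k < spreadValence w zero}
        ℕ.≤-total ℕ.≤-<-trans (low-magic 1≤n) magics
      high = extremum {Q = Magic S} {_≼_ = λ k k′ → k′ ≤ k} {D = λ k w → ∀ a → spreadValence w a < k}
        (λ k k′ → ℕ.≤-total k′ k) (λ k′≤k k′> a → ℕ.<-≤-trans (k′> a) k′≤k) high-magic magics
      lo = proj₁ low
      hi = proj₁ high
      lo< = proj₂ (proj₂ low)
      hi> = proj₂ (proj₂ high)
      middle = cartesianProductWith spreadValence (w ∷ L) (allFin (suc n))
      lo≢hi : lo ≢ hi
      lo≢hi = ℕ.<⇒≢ (ℕ.<-trans (All.head lo<) (All.head hi> zero))
      lo<spread : ∀ {w′} → w′ ∈ w ∷ L → ∀ a → lo < spreadValence w′ a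
      lo<spread {w′} w∈L a = ℕ.<-≤-trans (All.lookup lo< w∈L)
        (ℕ.+-monoʳ-≤ 3 (ℕ.+-monoʳ-≤ (suc n * w′) (ℕ.*-monoʳ-≤ 1 (ℕ.m≤n+m n (toℕ a)))))
      spread-all : ∀ {P : ℕ → Set} → (∀ {w′} → w′ ∈ w ∷ L → ∀ a → P (spreadValence w′ a)) → All P middle
      spread-all p = All.cartesianProductWith⁺ (setoid ℕ) (setoid (Fin (suc n))) spreadValence (w ∷ L) (allFin (suc n))
        (λ w∈L _ → p w∈L _)
      length-middle : length middle ≡ suc n * length (w ∷ L)
      length-middle = trans (length-cartesianProductWith spreadValence (w ∷ L) (allFin (suc n)))
        (trans (cong (length (w ∷ L) *_) (length-tabulate {n = suc n} (λ i → i))) (ℕ.*-comm (length (w ∷ L)) (suc n)))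

    offsets : ∀ {L} → All (Magic G) L → ∃[ L′ ] (L ≡ map (3 +_) L′)
    offsets [] = [] , refl
    offsets (magic ∷ magics) with magic≥3 eG magic | offsets magics
    ... | w , refl | L′ , refl = w ∷ L′ , refl

    cardGE : IsEdgeMagic G → CardGE (InTau G) (InTau S) (λ m → suc n * m + 2)
    cardGE (f , k , magic) L unique inTau = fromOffsets (proj₁ split) (proj₂ split) unique magics
      where
      magics : All (Magic G) L
      magics = All.map proj₂ inTau
      split = offsets magics
      fromOffsets : ∀ {L} L′ → L ≡ map (3 +_) L′ → Unique L → All (Magic G) L →
        ∃[ K ] (Unique K × All (InTau S) K × suc n * length L + 2 ≤ length K)
      fromOffsets (w ∷ L′) refl unique magics =
        subst (λ l → ∃[ K ] (Unique K × All (InTau S) K × suc n * suc l + 2 ≤ length K))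
          (sym (length-map (3 +_) L′)) (magic⇒CardGE w L′ (Unique.map⁻ unique) (All.map⁻ magics))
      fromOffsets [] refl _ _ = Product.map₂ (Product.map₂ (Product.map₂
          (ℕ.≤-trans (ℕ.+-monoˡ-≤ 2 (ℕ.*-monoʳ-≤ (suc n) (z≤n {1}))))))
        (magic⇒CardGE (proj₁ offset) [] ([] ∷ [])
          (subst (Magic G) (proj₂ offset) (f , magic) ∷ []))
        where offset = magic≥3 eG (f , magic)

  edgeless-InTau : ¬ Edge G → ∀ k → InTau S k
  edgeless-InTau edgeless k = magic⇒InTau (proj₁ enumeration , λ e → ⊥-elim (edgeless (baseEdge e)))
    where
    enumeration = labelWith S (toℕ ∘ Inverse.to (Elem↔Fin S)) (λ z → Fin.toℕ<n _)
      (Injection.injective (↔⇒↣ (Elem↔Fin S)) ∘ Fin.toℕ-injective)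

  edgeless-CardGE : ∀ {P} f → ¬ Edge G → CardGE P (InTau S) f
  edgeless-CardGE f edgeless L _ _ = upTo m , Unique.upTo⁺ m
    , All.universal (edgeless-InTau edgeless) (upTo m) , ℕ.≤-reflexive (sym (length-upTo m))
    where m = f (length L)

edge? : ∀ {a b} (E : BGraph a b) → Dec (Edge E)
edge? E = map′ (λ { (i , j , p) → (i , j) , p }) (λ { ((i , j) , p) → i , j , p })
  (Fin.any? λ i → Fin.any? λ j → E i j Bool.≟ true)

theorem3p6 : (s t n : ℕ) (G H₁ H₂ : BGraph s t) →
    1 ≤ n → IsEdgeMagic G → IsDecomposition G H₁ H₂ →
    CardGE (InTau G) (InTau (S2n n G H₁ H₂)) (λ m → suc n * m + 2)
theorem3p6 s t n G H₁ H₂ 1≤n magic decomposition = byEdge (edge? G)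
  where
  open Blowup n G H₁ H₂ decomposition
  byEdge : Dec (Edge G) → CardGE (InTau G) (InTau S) (λ m → suc n * m + 2)
  byEdge (yes e)       = cardGE 1≤n e magic
  byEdge (no edgeless) = edgeless-CardGE (λ m → suc n * m + 2) edgeless
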